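{- Let $A$ and $B$ be disjoint finite point sets in the plane such that $A\cup B$ is not collinear. Then the bivisibility graph $\mathcal{B}(A,B)$ has at most one connected component that is not an isolated vertex.
   Context: The bivisibility graph $\mathcal{B}(A,B)$ has vertex set $A\cup B$, where $v\in A$ and $w\in B$ are adjacent iff no point of $A\cup B$ lies in the open segment $vw$. -}

module Defs where

open import Level using (Level; _⊔_) renaming (suc to lsuc)
open import Algebra.Bundles using (CommutativeRing)
open import Relation.Binary.Structures using (IsStrictTotalOrder)
open import Relation.Nullary using (¬_)
open import Data.Product using (Σ; ∃; _×_; _,_)
open import Data.Sum using (_⊎_)
open import Data.List using (List)
open import Data.List.Relation.Unary.Any using (Any)
open import Relation.Binary.Construct.Closure.ReflexiveTransitive using (Star)

-- An ordered field (the plane is F × F; ℝ is an instance).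
record OrderedField (c ℓ : Level) : Set (lsuc (c ⊔ ℓ)) where
  field
    commutativeRing : CommutativeRing c ℓ
  open CommutativeRing commutativeRing public
  field
    _<_ : Carrier → Carrier → Set ℓ
    <-isStrictTotalOrder : IsStrictTotalOrder _≈_ _<_
    +-monoˡ-< : ∀ {x y} z → x < y → (x + z) < (y + z)
    *-pos : ∀ {x y} → 0# < x → 0# < y → 0# < (x * y)
    0<1 : 0# < 1#
    inverse : ∀ x → ¬ (x ≈ 0#) → ∃ λ y → (x * y) ≈ 1#

module Plane {c ℓ : Level} (F : OrderedField c ℓ) where
  open OrderedField F

  Point : Set c
  Point = Carrier × Carrier

  _≈P_ : Point → Point → Set ℓ
  (x₁ , y₁) ≈P (x₂ , y₂) = (x₁ ≈ x₂) × (y₁ ≈ y₂)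

  _∈P_ : Point → List Point → Set (c ⊔ ℓ)
  p ∈P S = Any (p ≈P_) S

  _∈A∪B_ : Point → List Point × List Point → Set (c ⊔ ℓ)
  p ∈A∪B (A , B) = (p ∈P A) ⊎ (p ∈P B)

  Disjoint : List Point → List Point → Set (c ⊔ ℓ)
  Disjoint A B = ∀ p → p ∈P A → ¬ (p ∈P B)

  Collinear : List Point → Set (c ⊔ ℓ)
  Collinear S = Σ Carrier λ a → Σ Carrier λ b → Σ Carrier λ k →
    ¬ ((a ≈ 0#) × (b ≈ 0#)) ×
    (∀ x y → (x , y) ∈P S → ((a * x) + (b * y)) ≈ k)

  InOpenSegment : Point → Point → Point → Set (c ⊔ ℓ)
  InOpenSegment (px , py) (vx , vy) (wx , wy) =
    Σ Carrier λ t → (0# < t) × (t < 1#) ×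
      (px ≈ (vx + (t * (wx - vx)))) × (py ≈ (vy + (t * (wy - vy))))

  Visible : List Point → List Point → Point → Point → Set (c ⊔ ℓ)
  Visible A B v w = ∀ p → p ∈A∪B (A , B) → ¬ InOpenSegment p v w

  BiAdj : List Point → List Point → Point → Point → Set (c ⊔ ℓ)
  BiAdj A B v w =
    ((v ∈P A × w ∈P B) ⊎ (v ∈P B × w ∈P A)) × Visible A B v w

  Connected : List Point → List Point → Point → Point → Set (c ⊔ ℓ)
  Connected A B = Star (BiAdj A B)

  NonIsolated : List Point → List Point → Point → Set (c ⊔ ℓ)
  NonIsolated A B v = ∃ λ w → BiAdj A B v w

-- Of two edges ab and cd with no common endpoint and not on one line, one, say ab, has both
-- endpoints extreme in {a, b, c, d}. Moving c towards a or b past every blocking point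
-- yields a point q off the line ab in the triangle abc that sees both a and b, hence is
-- adjacent to one of them. Replacing the other one by q keeps the edge in its component and
-- removes an extreme point from the convex hull of the four endpoints, so induction on the
-- number of points in that hull joins the two edges. If the endpoints are collinear, a point
-- off the line that sees all of them is adjacent to an endpoint of either edge.

module Submission where

open import Defs
open import Algebra.Bundles using (CommutativeMonoid; CommutativeRing)
open import Data.List using (List; []; _∷_; _++_; length; filter)
open import Data.List.Properties using (filter-notAll)
open import Data.List.Membership.Propositional using (find; lose)
open import Data.List.Relation.Unary.All using (All; []; _∷_)
open import Data.List.Relation.Unary.Any as Any using (Any; any?)
open import Data.List.Relation.Unary.Any.Properties using (++⁺ˡ; ++⁺ʳ; ++⁻)
import Data.List.Membership.Setoid.Properties as Membership
open import Data.Nat as ℕ using (zero; suc; s≤s)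
import Data.Nat.Properties as ℕ
open import Data.Product using (∃; _×_; _,_; proj₁; proj₂)
import Data.Product as Product
open import Data.Product.Relation.Binary.Pointwise.NonDependent using (×-setoid)
open import Data.Sum using (_⊎_; inj₁; inj₂; [_,_]′) renaming (swap to ⊎-swap; map to ⊎-map)
open import Function using (_∘_)
open import Level using (_⊔_)
open import Relation.Binary using (IsStrictTotalOrder; _Respects_; Tri; tri<; tri≈; tri>)
open import Relation.Binary.Construct.Closure.ReflexiveTransitive using (ε; _◅_; _◅◅_; reverse)
import Relation.Binary.PropositionalEquality as ≡
open import Relation.Nullary using (¬_; Dec; yes; no; contradiction)
open import Relation.Nullary.Decidable using (_×-dec_; ¬?; map′; decidable-stable)
open import Relation.Unary using (Pred; Decidable)

-- A ring solver with integer coefficients.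

module IntegerCoefficientSolver {c ℓ} (R : CommutativeRing c ℓ) where
  open CommutativeRing R
  open import Algebra.Properties.Ring ring
  open import Algebra.Properties.AbelianGroup +-abelianGroup using (⁻¹-∙-comm)
  open import Algebra.Properties.CommutativeSemigroup
    (CommutativeMonoid.commutativeSemigroup +-commutativeMonoid) using (interchange)
  open import Algebra.Properties.Semiring.Mult.TCOptimised semiring renaming (_×_ to infixl 8 _×′_)
  open import Algebra.Solver.Ring.AlmostCommutativeRing
    using (fromCommutativeRing; _-Raw-AlmostCommutative⟶_)
  open import Data.Integer.Base as ℤ using (ℤ; +_; -[1+_]; _⊖_)
  import Data.Integer.Properties as ℤ
  open import Data.Maybe.Base using (Maybe)
  import Data.Maybe.Base as Maybe
  open import Relation.Nullary.Decidable.Core using (dec⇒maybe)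
  open import Relation.Binary.Reasoning.Setoid setoid

  -- Equality of integers is decidable, so with integer coefficients the solver can recognise terms
  -- that cancel, which an arbitrary commutative ring gives no means to do.
  fromℤ : ℤ → Carrier
  fromℤ (+ n)    = n ×′ 1#
  fromℤ -[1+ n ] = - (suc n ×′ 1#)

  -- The induction strips a successor from both numbers, and the two units stripped cancel.
  fromℤ-⊖ : ∀ m n → fromℤ (m ⊖ n) ≈ m ×′ 1# - n ×′ 1#
  fromℤ-⊖ m zero = sym (trans (+-congˡ -0#≈0#) (+-identityʳ _))
  fromℤ-⊖ zero (suc n) = sym (+-identityˡ _)
  fromℤ-⊖ (suc m) (suc n) = begin
    fromℤ (suc m ⊖ suc n)             ≡⟨ ≡.cong fromℤ (ℤ.[1+m]⊖[1+n]≡m⊖n m n) ⟩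
    fromℤ (m ⊖ n)                     ≈⟨ fromℤ-⊖ m n ⟩
    m ×′ 1# - n ×′ 1#                   ≈⟨ +-identityˡ _ ⟨
    0# + (m ×′ 1# - n ×′ 1#)            ≈⟨ +-congʳ (-‿inverseʳ 1#) ⟨
    (1# - 1#) + (m ×′ 1# - n ×′ 1#)     ≈⟨ interchange _ _ _ _ ⟩
    (1# + m ×′ 1#) + (- 1# - n ×′ 1#)   ≈⟨ +-congˡ (⁻¹-∙-comm _ _) ⟩
    (1# + m ×′ 1#) - (1# + n ×′ 1#)     ≈⟨ +-cong (×-homo-+ 1# 1 m) (-‿cong (×-homo-+ 1# 1 n)) ⟨
    suc m ×′ 1# - suc n ×′ 1#           ∎

  fromℤ-homo-neg : ∀ i → fromℤ (ℤ.- i) ≈ - fromℤ i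
  fromℤ-homo-neg (+ zero)  = sym -0#≈0#
  fromℤ-homo-neg (+ suc n) = refl
  fromℤ-homo-neg -[1+ n ]  = sym (-‿involutive _)

  fromℤ-homo-+ : ∀ i j → fromℤ (i ℤ.+ j) ≈ fromℤ i + fromℤ j
  fromℤ-homo-+ (+ m)    (+ n)    = ×-homo-+ 1# m n
  fromℤ-homo-+ (+ m)    -[1+ n ] = fromℤ-⊖ m (suc n)
  fromℤ-homo-+ -[1+ m ] (+ n)    = trans (fromℤ-⊖ n (suc m)) (+-comm _ _)
  fromℤ-homo-+ -[1+ m ] -[1+ n ] = begin
    fromℤ (-[1+ m ] ℤ.+ -[1+ n ])         ≡⟨ ≡.cong fromℤ (ℤ.neg-distrib-+ (+ suc m) (+ suc n)) ⟨
    fromℤ (ℤ.- (+ suc m ℤ.+ + suc n))     ≈⟨ fromℤ-homo-neg (+ suc m ℤ.+ + suc n) ⟩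
    - ((suc m ℕ.+ suc n) ×′ 1#)            ≈⟨ -‿cong (×-homo-+ 1# (suc m) (suc n)) ⟩
    - (suc m ×′ 1# + suc n ×′ 1#)           ≈⟨ ⁻¹-∙-comm _ _ ⟨
    - (suc m ×′ 1#) - suc n ×′ 1#           ∎

  fromℤ-homo-*⁺ : ∀ m j → fromℤ (+ m ℤ.* j) ≈ fromℤ (+ m) * fromℤ j
  fromℤ-homo-*⁺ m (+ n) = trans (reflexive (≡.cong fromℤ (≡.sym (ℤ.pos-* m n)))) (×1-homo-* m n)
  fromℤ-homo-*⁺ m -[1+ n ] = begin
    fromℤ (+ m ℤ.* (ℤ.- + suc n))   ≡⟨ ≡.cong fromℤ (ℤ.neg-distribʳ-* (+ m) (+ suc n)) ⟨
    fromℤ (ℤ.- (+ m ℤ.* + suc n))   ≈⟨ fromℤ-homo-neg (+ m ℤ.* + suc n) ⟩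
    - fromℤ (+ m ℤ.* + suc n)       ≈⟨ -‿cong (fromℤ-homo-*⁺ m (+ suc n)) ⟩
    - (m ×′ 1# * (suc n ×′ 1#))       ≈⟨ -‿distribʳ-* _ _ ⟩
    m ×′ 1# * - (suc n ×′ 1#)         ∎

  fromℤ-homo-* : ∀ i j → fromℤ (i ℤ.* j) ≈ fromℤ i * fromℤ j
  fromℤ-homo-* (+ m)    j = fromℤ-homo-*⁺ m j
  fromℤ-homo-* -[1+ m ] j = begin
    fromℤ ((ℤ.- + suc m) ℤ.* j)   ≡⟨ ≡.cong fromℤ (ℤ.neg-distribˡ-* (+ suc m) j) ⟨
    fromℤ (ℤ.- (+ suc m ℤ.* j))   ≈⟨ fromℤ-homo-neg (+ suc m ℤ.* j) ⟩
    - fromℤ (+ suc m ℤ.* j)       ≈⟨ -‿cong (fromℤ-homo-*⁺ (suc m) j) ⟩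
    - (suc m ×′ 1# * fromℤ j)      ≈⟨ -‿distribˡ-* _ _ ⟩
    - (suc m ×′ 1#) * fromℤ j      ∎

  fromℤ-morphism : ℤ.+-*-rawRing -Raw-AlmostCommutative⟶ fromCommutativeRing R
  fromℤ-morphism = record
    { ⟦_⟧    = fromℤ
    ; +-homo = fromℤ-homo-+
    ; *-homo = fromℤ-homo-*
    ; -‿homo = fromℤ-homo-neg
    ; 0-homo = refl
    ; 1-homo = refl
    }

  fromℤ≈? : ∀ i j → Maybe (fromℤ i ≈ fromℤ j)
  fromℤ≈? i j = Maybe.map (λ i≡j → reflexive (≡.cong fromℤ i≡j)) (dec⇒maybe (i ℤ.≟ j))

  open import Algebra.Solver.Ring ℤ.+-*-rawRing (fromCommutativeRing R) fromℤ-morphism fromℤ≈? public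
    using (solve; _:=_; _:+_; _:*_; _:-_; :-_; con)

-- Order arithmetic in an ordered field.

module OrderedFieldProperties {c ℓ} (F : OrderedField c ℓ) where
  open OrderedField F renaming (_<_ to infix 4 _<_)
  open IsStrictTotalOrder <-isStrictTotalOrder public
    using (compare; _≟_; _<?_; irrefl; <-respˡ-≈; <-respʳ-≈) renaming (trans to <-trans)
  open IntegerCoefficientSolver commutativeRing public
  open import Algebra.Properties.Ring ring public using (-0#≈0#)
  open import Data.Integer.Base using (+_)

  <⇒0< : ∀ {x y} → x < y → 0# < y - x
  <⇒0< {x} x<y = <-respˡ-≈ (-‿inverseʳ x) (+-monoˡ-< (- x) x<y)

  -- The extra variable `z` fixes the pattern of the later inequalities: the difference of the two
  -- sides is rewritten as a visibly positive expression, and the solver checks the identity.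
  0<⇒< : ∀ {x y z} → 0# < z → z ≈ y - x → x < y
  0<⇒< {x} {y} 0<z z≈y-x =
    <-respˡ-≈ (+-identityˡ x)
      (<-respʳ-≈ (solve 2 (λ x y → (y :- x) :+ x := y) refl x y)
        (+-monoˡ-< x (<-respʳ-≈ z≈y-x 0<z)))

  +-pos : ∀ {x y} → 0# < x → 0# < y → 0# < x + y
  +-pos {x} {y} 0<x 0<y = <-trans 0<y (<-respˡ-≈ (+-identityˡ y) (+-monoˡ-< y 0<x))

  neg-anti-mono-< : ∀ {x y} → x < y → - y < - x
  neg-anti-mono-< {x} {y} x<y =
    0<⇒< (<⇒0< x<y) (solve 2 (λ x y → y :- x := (:- x) :- (:- y)) refl x y)

  *-monoˡ-<-pos : ∀ {z x y} → 0# < z → x < y → z * x < z * y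
  *-monoˡ-<-pos {z} {x} {y} 0<z x<y =
    0<⇒< (*-pos 0<z (<⇒0< x<y))
      (solve 3 (λ z x y → z :* (y :- x) := z :* y :- z :* x) refl z x y)

  <⇒≉ : ∀ {x y} → x < y → ¬ y ≈ x
  <⇒≉ x<y y≈x = irrefl (sym y≈x) x<y

  -- An inverse that is zero or negative would make 1 = xy zero or negative.
  positive-inverse : ∀ {x} → 0# < x → ∃ λ y → 0# < y × x * y ≈ 1#
  positive-inverse {x} 0<x with inverse x (<⇒≉ 0<x)
  ... | y , xy≈1 with compare 0# y
  ... | tri< 0<y _ _ = y , 0<y , xy≈1
  ... | tri≈ _ 0≈y _ =
    contradiction 0<1 (irrefl (trans (sym (zeroʳ x)) (trans (*-congˡ 0≈y) xy≈1)))
  ... | tri> _ _ y<0 =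
    contradiction (<-trans 0<1 (<-respˡ-≈ xy≈1 (<-respʳ-≈ (zeroʳ x) (*-monoˡ-<-pos 0<x y<0))))
      (irrefl refl)

  *-cancelˡ-0 : ∀ {x y} → ¬ x ≈ 0# → x * y ≈ 0# → y ≈ 0#
  *-cancelˡ-0 {x} {y} x≉0 xy≈0 with inverse x x≉0
  ... | i , xi≈1 = begin
    y            ≈⟨ *-identityˡ y ⟨
    1# * y       ≈⟨ *-congʳ xi≈1 ⟨
    x * i * y    ≈⟨ solve 3 (λ x i y → x :* i :* y := i :* (x :* y)) refl x i y ⟩
    i * (x * y)  ≈⟨ *-congˡ xy≈0 ⟩
    i * 0#       ≈⟨ zeroʳ i ⟩
    0#           ∎
    where open import Relation.Binary.Reasoning.Setoid setoid

  x-y≈0⇒x≈y : ∀ {x y} → x - y ≈ 0# → x ≈ y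
  x-y≈0⇒x≈y {x} {y} x-y≈0 =
    trans (solve 2 (λ x y → x := (x :- y) :+ y) refl x y) (trans (+-congʳ x-y≈0) (+-identityˡ y))

  x≈y⇒x-y≈0 : ∀ {x y} → x ≈ y → x - y ≈ 0#
  x≈y⇒x-y≈0 {x} {y} x≈y = trans (+-congʳ x≈y) (-‿inverseʳ y)

  -- The quotient (r + 1) / x times `x` exceeds `r`, and enlarging a multiplier of a positive number
  -- preserves this. So the larger of the two quotients serves both bounds.
  common-multiplier : ∀ r s {x y} → 0# < x → 0# < y → ∃ λ m → r < m * x × s < m * y
  common-multiplier r s {x} {y} 0<x 0<y = larger (multiple r 0<x) (multiple s 0<y)
    where
    multiple : ∀ r {x} → 0# < x → ∃ λ m → r < m * x
    multiple r {x} 0<x with positive-inverse 0<x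
    ... | i , _ , xi≈1 = (r + 1#) * i , 0<⇒< 0<1 (begin
      1#                    ≈⟨ solve 1 (λ r → con (+ 1) := (r :+ con (+ 1)) :* con (+ 1) :- r) refl r ⟩
      (r + 1#) * 1# - r     ≈⟨ +-congʳ (*-congˡ xi≈1) ⟨
      (r + 1#) * (x * i) - r ≈⟨ solve 3 (λ r x i → (r :+ con (+ 1)) :* (x :* i) :- r
                                            := (r :+ con (+ 1)) :* i :* x :- r) refl r x i ⟩
      (r + 1#) * i * x - r  ∎)
      where open import Relation.Binary.Reasoning.Setoid setoid

    increase : ∀ {m n r z} → 0# < z → m < n → r < m * z → r < n * z
    increase {m} {n} {z = z} 0<z m<n r<mz =
      <-trans r<mz (<-respˡ-≈ (*-comm z m) (<-respʳ-≈ (*-comm z n) (*-monoˡ-<-pos 0<z m<n)))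

    larger : ∃ (λ m → r < m * x) → ∃ (λ n → s < n * y) → ∃ λ m → r < m * x × s < m * y
    larger (m , r<mx) (n , s<ny) with compare m n
    ... | tri< m<n _ _ = n , increase 0<x m<n r<mx , s<ny
    ... | tri≈ _ m≈n _ = m , r<mx , <-respʳ-≈ (*-congʳ (sym m≈n)) s<ny
    ... | tri> _ _ n<m = m , r<mx , increase 0<y n<m s<ny

-- Points, and searches through finite point lists.

module PlaneProperties {c ℓ} (F : OrderedField c ℓ) where
  open OrderedField F renaming (_<_ to infix 4 _<_)
  open OrderedFieldProperties F
  open Plane F
  open import Data.Integer.Base using (+_)

  ≈P-refl : ∀ {p} → p ≈P p
  ≈P-refl = refl , refl

  ≈P-sym : ∀ {p q} → p ≈P q → q ≈P p
  ≈P-sym (x≈ , y≈) = sym x≈ , sym y≈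

  ≈P-trans : ∀ {p q r} → p ≈P q → q ≈P r → p ≈P r
  ≈P-trans (x≈ , y≈) (x≈′ , y≈′) = trans x≈ x≈′ , trans y≈ y≈′

  _≟P_ : ∀ p q → Dec (p ≈P q)
  (x , y) ≟P (x′ , y′) = (x ≟ x′) ×-dec (y ≟ y′)

  ∈P-resp : ∀ {S p q} → p ≈P q → p ∈P S → q ∈P S
  ∈P-resp p≈q = Any.map (≈P-trans (≈P-sym p≈q))

  search : ∀ {q} (Q : Pred Point q) → Q Respects _≈P_ → Decidable Q → ∀ S →
           (∃ λ p → p ∈P S × Q p) ⊎ (∀ p → p ∈P S → ¬ Q p)
  search Q resp Q? S with any? Q? S
  ... | yes any = let (p , p∈S , Qp) = find any in
                  inj₁ (p , lose p∈S ≈P-refl , Qp)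
  ... | no ¬any = inj₂ λ p p∈S Qp → ¬any (Any.map (λ p≈x → resp p≈x Qp) p∈S)

  -- Filtering drops at least the entry equal to `x`. This strict decrease drives both inductions,
  -- the one on points below a given height and the one on points in a hull.
  sublist : ∀ {q} {Q : Pred Point q} → Q Respects _≈P_ → Decidable Q → ∀ S {x} → x ∈P S → ¬ Q x →
            ∃ λ S′ → length S′ ℕ.< length S × (∀ p → p ∈P S → Q p → p ∈P S′)
  sublist {Q = Q} resp Q? S x∈S ¬Qx =
    filter Q? S ,
    filter-notAll Q? S (Any.map (λ x≈z Qz → ¬Qx (resp (≈P-sym x≈z) Qz)) x∈S) ,
    λ p p∈S Qp → Membership.∈-filter⁺ (×-setoid setoid setoid) Q? resp p∈S Qp

  -- Linear functionals and open segments.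

  Functional : Set c
  Functional = Carrier × Carrier

  infix 8 _·_
  infix 9 neg_

  _·_ : Functional → Point → Carrier
  (α , β) · (x , y) = α * x + β * y

  neg_ : Functional → Functional
  neg (α , β) = - α , - β

  combine : Carrier → Functional → Carrier → Functional → Functional
  combine s (α , β) r (γ , δ) = s * α + r * γ , s * β + r * δ

  ·-cong : ∀ φ {p q} → p ≈P q → φ · p ≈ φ · q
  ·-cong φ (x≈ , y≈) = +-cong (*-congˡ x≈) (*-congˡ y≈)

  neg-· : ∀ φ p → neg φ · p ≈ - (φ · p)
  neg-· (α , β) (x , y) =
    solve 4 (λ α β x y → (:- α) :* x :+ (:- β) :* y := :- (α :* x :+ β :* y)) refl α β x y

  combine-· : ∀ s φ r ψ p → combine s φ r ψ · p ≈ s * φ · p + r * ψ · p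
  combine-· s (α , β) r (γ , δ) (x , y) =
    trans (+-cong (expand s α r γ x) (expand s β r δ y))
      (trans (regroup _ _ _ _) (sym (+-cong (distribˡ s _ _) (distribˡ r _ _))))
    where
    expand : ∀ s α r γ x → (s * α + r * γ) * x ≈ s * (α * x) + r * (γ * x)
    expand = solve 5 (λ s α r γ x → (s :* α :+ r :* γ) :* x := s :* (α :* x) :+ r :* (γ :* x)) refl
    regroup : ∀ u v w z → (u + v) + (w + z) ≈ (u + w) + (v + z)
    regroup = solve 4 (λ u v w z → (u :+ v) :+ (w :+ z) := (u :+ w) :+ (v :+ z)) refl

  neg-≈ : ∀ φ {p q} → φ · p ≈ φ · q → neg φ · p ≈ neg φ · q
  neg-≈ φ {p} {q} e = trans (neg-· φ p) (trans (-‿cong e) (sym (neg-· φ q)))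

  neg-≈⁻ : ∀ φ {p q} → neg φ · p ≈ neg φ · q → φ · p ≈ φ · q
  neg-≈⁻ φ {p} {q} e = trans (invol p) (trans (-‿cong e) (sym (invol q)))
    where
    invol : ∀ p → φ · p ≈ - (neg φ · p)
    invol p = trans (solve 1 (λ x → x := :- (:- x)) refl (φ · p)) (-‿cong (sym (neg-· φ p)))

  neg-< : ∀ φ {p q} → φ · p < φ · q → neg φ · q < neg φ · p
  neg-< φ {p} {q} lt =
    <-respˡ-≈ (sym (neg-· φ q)) (<-respʳ-≈ (sym (neg-· φ p)) (neg-anti-mono-< lt))

  Nonzero : Functional → Set ℓ
  Nonzero (α , β) = ¬ (α ≈ 0# × β ≈ 0#)

  neg-nonzero : ∀ φ → Nonzero φ → Nonzero (neg φ)
  neg-nonzero (α , β) nz (α≈0 , β≈0) = nz (neg≈0 α≈0 , neg≈0 β≈0)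
    where
    neg≈0 : ∀ {x} → - x ≈ 0# → x ≈ 0#
    neg≈0 {x} e = trans (solve 1 (λ x → x := :- (:- x)) refl x) (trans (-‿cong e) -0#≈0#)

  -- A functional is affine along a segment, so its value interpolates with the same parameter. The
  -- other facts about values on segments reduce to this one-dimensional formula.
  segment-· : ∀ {p v w} → (s : InOpenSegment p v w) → ∀ φ →
              φ · p ≈ φ · v + proj₁ s * (φ · w - φ · v)
  segment-· {p} {vx , vy} {wx , wy} (t , _ , _ , px≈ , py≈) φ@(α , β) =
    trans (·-cong φ (px≈ , py≈))
      (trans (+-cong (expand α vx wx) (expand β vy wy)) (regroup _ _ _ _))
    where
    expand : ∀ α v w → α * (v + t * (w - v)) ≈ α * v + t * (α * w - α * v)
    expand = solve 4 (λ t α v w → α :* (v :+ t :* (w :- v))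
                                    := α :* v :+ t :* (α :* w :- α :* v)) refl t
    regroup : ∀ x y z w → (x + t * (z - x)) + (y + t * (w - y)) ≈ (x + y) + t * ((z + w) - (x + y))
    regroup = solve 5 (λ t x y z w → (x :+ t :* (z :- x)) :+ (y :+ t :* (w :- y))
                                       := (x :+ y) :+ t :* ((z :+ w) :- (x :+ y))) refl t

  -- Since t < 1, the weight 1 - t of `v` is positive, so strictness at `v` alone carries over to
  -- `p`; at `w` a weak bound is enough.
  segment-<-bound : ∀ {p v w} → InOpenSegment p v w → ∀ φ {m} →
                    φ · v < m → φ · w < m ⊎ φ · w ≈ m → φ · p < m
  segment-<-bound {p} {v} {w} s@(t , 0<t , t<1 , _) φ {m} v<m w≤m =
    <-respˡ-≈ (sym (segment-· s φ)) ([ strict , weak ]′ w≤m)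
    where
    V W : Carrier
    V = φ · v
    W = φ · w
    strict : W < m → V + t * (W - V) < m
    strict w<m = 0<⇒< (+-pos (*-pos (<⇒0< t<1) (<⇒0< v<m)) (*-pos 0<t (<⇒0< w<m)))
      (solve 4 (λ t V W m → (con (+ 1) :- t) :* (m :- V) :+ t :* (m :- W)
                              := m :- (V :+ t :* (W :- V))) refl t V W m)
    weak : W ≈ m → V + t * (W - V) < m
    weak w≈m = <-respˡ-≈ (+-congˡ (*-congˡ (+-congʳ (sym w≈m))))
      (0<⇒< (*-pos (<⇒0< t<1) (<⇒0< v<m))
        (solve 3 (λ t V m → (con (+ 1) :- t) :* (m :- V)
                              := m :- (V :+ t :* (m :- V))) refl t V m))

  segment-between : ∀ {p v w} → InOpenSegment p v w → ∀ φ →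
                    φ · w < φ · v → φ · w < φ · p × φ · p < φ · v
  segment-between {p} {v} {w} s@(t , 0<t , t<1 , _) φ w<v =
    <-respʳ-≈ (sym (segment-· s φ)) (0<⇒< (*-pos (<⇒0< t<1) (<⇒0< w<v))
      (solve 3 (λ t V W → (con (+ 1) :- t) :* (V :- W)
                              := (V :+ t :* (W :- V)) :- W) refl t (φ · v) (φ · w))) ,
    <-respˡ-≈ (sym (segment-· s φ)) (0<⇒< (*-pos 0<t (<⇒0< w<v))
      (solve 3 (λ t V W → t :* (V :- W)
                              := V :- (V :+ t :* (W :- V))) refl t (φ · v) (φ · w)))

  segment-sym : ∀ {p v w} → InOpenSegment p v w → InOpenSegment p w v
  segment-sym {p} {vx , vy} {wx , wy} (t , 0<t , t<1 , px≈ , py≈) =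
    1# - t , <⇒0< t<1 , 0<⇒< 0<t (solve 1 (λ t → t := con (+ 1) :- (con (+ 1) :- t)) refl t) ,
    trans px≈ (reparametrise vx wx) , trans py≈ (reparametrise vy wy)
    where
    reparametrise : ∀ v w → v + t * (w - v) ≈ w + (1# - t) * (v - w)
    reparametrise = solve 3 (λ t v w → v :+ t :* (w :- v)
                                         := w :+ (con (+ 1) :- t) :* (v :- w)) refl t

  segment-resp : ∀ {p p′ v v′ w} → p ≈P p′ → v ≈P v′ → InOpenSegment p v w → InOpenSegment p′ v′ w
  segment-resp (px≈ , py≈) (vx≈ , vy≈) (t , 0<t , t<1 , x≈ , y≈) =
    t , 0<t , t<1 ,
    trans (sym px≈) (trans x≈ (+-cong vx≈ (*-congˡ (+-congˡ (-‿cong vx≈))))) ,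
    trans (sym py≈) (trans y≈ (+-cong vy≈ (*-congˡ (+-congˡ (-‿cong vy≈)))))

  -- Deciding membership in a segment means deciding an existential over the whole field. A
  -- functional that separates the ends leaves a single candidate for the parameter, which can be
  -- tested.
  segment-parameter : ∀ {p v w} φ → φ · w < φ · v →
                      ∃ λ t₀ → ∀ t → φ · p ≈ φ · v + t * (φ · w - φ · v) → t ≈ t₀
  segment-parameter {p} {v} {w} φ w<v = solution (positive-inverse (<⇒0< w<v))
    where
    P V W : Carrier
    P = φ · p
    V = φ · v
    W = φ · w
    solution : (∃ λ i → 0# < i × (V - W) * i ≈ 1#) →
               ∃ λ t₀ → ∀ t → P ≈ V + t * (W - V) → t ≈ t₀
    -- With `i` = 1 / (V - W), this is the interpolation formula solved for t.
    solution (i , _ , inv) = (V - P) * i , λ t e → begin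
      t                             ≈⟨ *-identityʳ t ⟨
      t * 1#                        ≈⟨ *-congˡ inv ⟨
      t * ((V - W) * i)             ≈⟨ solve 4 (λ t v w i → t :* ((v :- w) :* i)
                                         := (v :- (v :+ t :* (w :- v))) :* i) refl t V W i ⟩
      (V - (V + t * (W - V))) * i   ≈⟨ *-congʳ (+-congˡ (-‿cong e)) ⟨
      (V - P) * i                   ∎
      where open import Relation.Binary.Reasoning.Setoid setoid

  segment? : ∀ φ {v w} → φ · w < φ · v → ∀ p → Dec (InOpenSegment p v w)
  segment? φ {v} {w} w<v p = decide (segment-parameter φ w<v)
    where
    Between : Carrier → Set ℓ
    Between t = 0# < t × t < 1# ×
                proj₁ p ≈ proj₁ v + t * (proj₁ w - proj₁ v) ×
                proj₂ p ≈ proj₂ v + t * (proj₂ w - proj₂ v)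
    between-resp : ∀ {t t′} → t ≈ t′ → Between t → Between t′
    between-resp t≈t′ (0<t , t<1 , x≈ , y≈) =
      <-respʳ-≈ t≈t′ 0<t , <-respˡ-≈ t≈t′ t<1 ,
      trans x≈ (+-congˡ (*-congʳ t≈t′)) , trans y≈ (+-congˡ (*-congʳ t≈t′))
    between? : ∀ t → Dec (Between t)
    between? t = (0# <? t) ×-dec (t <? 1#) ×-dec (_ ≟ _) ×-dec (_ ≟ _)
    decide : (∃ λ t₀ → ∀ t → φ · p ≈ φ · v + t * (φ · w - φ · v) → t ≈ t₀) →
             Dec (InOpenSegment p v w)
    decide (t₀ , unique) = map′ (t₀ ,_)
      (λ (s : InOpenSegment p v w) →
        between-resp (unique (proj₁ s) (segment-· {p} {v} {w} s φ)) (proj₂ s))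
      (between? t₀)

  -- φ is constant on the line ab, g is a coordinate along it.
  record Frame (a b : Point) : Set (c ⊔ ℓ) where
    field
      φ g       : Functional
      nonzero   : Nonzero φ
      φ-const   : φ · a ≈ φ · b
      g-incr    : g · a < g · b
      injective : ∀ p q → φ · p ≈ φ · q → g · p ≈ g · q → p ≈P q

  frame-neg : ∀ {a b} → Frame a b → Frame a b
  frame-neg f = record
    { φ = neg φ ; g = g ; nonzero = neg-nonzero φ nonzero ; φ-const = neg-≈ φ φ-const
    ; g-incr = g-incr ; injective = λ p q → injective p q ∘ neg-≈⁻ φ }
    where open Frame f

  frame-swap : ∀ {a b} → Frame a b → Frame b a
  frame-swap f = record
    { φ = φ ; g = neg g ; nonzero = nonzero ; φ-const = sym φ-const
    ; g-incr = neg-< g g-incr ; injective = λ p q φ≈ g≈ → injective p q φ≈ (neg-≈⁻ g g≈) }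
    where open Frame f

  -- Its value at p is the cross product of b - a with p.
  lineFunctional : Point → Point → Functional
  lineFunctional (ax , ay) (bx , by) = ay - by , bx - ax

  lineFunctional-const : ∀ a b → lineFunctional a b · a ≈ lineFunctional a b · b
  lineFunctional-const (ax , ay) (bx , by) =
    solve 4 (λ ax ay bx by → (ay :- by) :* ax :+ (bx :- ax) :* ay
                               := (ay :- by) :* bx :+ (bx :- ax) :* by) refl ax ay bx by

  frame-x : ∀ {a b} → proj₁ a < proj₁ b → Frame a b
  frame-x {a@(ax , ay)} {b@(bx , by)} ax<bx = record
    { φ = lineFunctional a b ; g = 1# , 0#
    ; nonzero = λ (_ , e) → bx-ax≉0 e
    ; φ-const = lineFunctional-const a b
    ; g-incr = <-respˡ-≈ (sym (g-x ax ay)) (<-respʳ-≈ (sym (g-x bx by)) ax<bx)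
    ; injective = λ (px , py) (qx , qy) φ≈ g≈ →
        let px≈qx = trans (sym (g-x px py)) (trans g≈ (g-x qx qy)) in
        px≈qx ,
        -- The difference of the `φ` values, less its x part, is (bx - ax)(py - qy), and bx - ax is
        -- nonzero.
        x-y≈0⇒x≈y (*-cancelˡ-0 bx-ax≉0
          (trans (solve 6 (λ u v px py qx qy →
                    v :* (py :- qy) := ((u :* px :+ v :* py) :- (u :* qx :+ v :* qy)) :- u :* (px :- qx))
                    refl (ay - by) (bx - ax) px py qx qy)
          (trans (+-cong (x≈y⇒x-y≈0 φ≈) (-‿cong (trans (*-congˡ (x≈y⇒x-y≈0 px≈qx)) (zeroʳ _))))
            (-‿inverseʳ 0#))))
    }
    where
    bx-ax≉0 : ¬ bx - ax ≈ 0#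
    bx-ax≉0 = <⇒≉ (<⇒0< ax<bx)
    g-x : ∀ x y → 1# * x + 0# * y ≈ x
    g-x = solve 2 (λ x y → con (+ 1) :* x :+ con (+ 0) :* y := x) refl

  frame-y : ∀ {a b} → proj₂ b < proj₂ a → Frame a b
  frame-y {a@(ax , ay)} {b@(bx , by)} by<ay = record
    { φ = lineFunctional a b ; g = 0# , - 1#
    ; nonzero = λ (e , _) → ay-by≉0 e
    ; φ-const = lineFunctional-const a b
    ; g-incr = <-respˡ-≈ (sym (g-y ax ay)) (<-respʳ-≈ (sym (g-y bx by)) (neg-anti-mono-< by<ay))
    ; injective = λ (px , py) (qx , qy) φ≈ g≈ →
        let -py≈-qy = trans (sym (g-y px py)) (trans g≈ (g-y qx qy)) in
        x-y≈0⇒x≈y (*-cancelˡ-0 ay-by≉0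
          (trans (solve 6 (λ u v px py qx qy →
                    u :* (px :- qx) := ((u :* px :+ v :* py) :- (u :* qx :+ v :* qy))
                                         :+ v :* ((:- py) :- (:- qy)))
                    refl (ay - by) (bx - ax) px py qx qy)
          (trans (+-cong (x≈y⇒x-y≈0 φ≈) (trans (*-congˡ (x≈y⇒x-y≈0 -py≈-qy)) (zeroʳ _)))
            (+-identityˡ 0#)))) ,
        trans (solve 1 (λ x → x := :- (:- x)) refl py)
          (trans (-‿cong -py≈-qy) (solve 1 (λ x → :- (:- x) := x) refl qy))
    }
    where
    ay-by≉0 : ¬ ay - by ≈ 0#
    ay-by≉0 = <⇒≉ (<⇒0< by<ay)
    g-y : ∀ x y → 0# * x + (- 1#) * y ≈ - y
    g-y = solve 2 (λ x y → con (+ 0) :* x :+ (:- con (+ 1)) :* y := :- y) refl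

  frame : ∀ a b → ¬ a ≈P b → Frame a b
  frame (ax , ay) (bx , by) a≉b with compare ax bx | compare ay by
  ... | tri< ax<bx _ _ | _              = frame-x ax<bx
  ... | tri> _ _ bx<ax | _              = frame-swap (frame-x bx<ax)
  ... | tri≈ _ _ _     | tri< ay<by _ _ = frame-swap (frame-y ay<by)
  ... | tri≈ _ _ _     | tri> _ _ by<ay = frame-y by<ay
  ... | tri≈ _ ax≈bx _ | tri≈ _ ay≈by _ = contradiction (ax≈bx , ay≈by) a≉b

-- Relative position of two segments.

module FourPoints {κ ℓ} (F : OrderedField κ ℓ) where
  open OrderedField F renaming (_<_ to infix 4 _<_)
  open OrderedFieldProperties F
  open Plane F
  open PlaneProperties F
  open import Data.Integer.Base using (+_)

  Comparison : Carrier → Carrier → Set ℓ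
  Comparison x y = Tri (x < y) (x ≈ y) (y < x)

  -- The sign of `φ` is normalised so that `c` and `d` lie on the positive side of the line ab;
  -- `sameSide-below` covers the other sign.
  record SameSide (a b c d : Point) : Set (κ ⊔ ℓ) where
    constructor sameSide
    field
      φ       : Functional
      φ-const : φ · a ≈ φ · b
      c-above : φ · a < φ · c
      d-above : φ · a < φ · d

  sameSide-below : ∀ {a b c d} φ → φ · a ≈ φ · b → φ · c < φ · a → φ · d < φ · a → SameSide a b c d
  sameSide-below φ a≈b c<a d<a = sameSide (neg φ) (neg-≈ φ a≈b) (neg-< φ c<a) (neg-< φ d<a)

  sameSide-swap : ∀ {a b c d} → SameSide a b c d → SameSide b a c d
  sameSide-swap (sameSide φ a≈b a<c a<d) =
    sameSide φ (sym a≈b) (<-respˡ-≈ a≈b a<c) (<-respˡ-≈ a≈b a<d)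

  -- A line strictly separates `a` from the other three points, so `a` is a vertex of their hull.
  Extreme : Point → Point → Point → Point → Set (κ ⊔ ℓ)
  Extreme a b c d = ∃ λ ψ → ψ · b < ψ · a × ψ · c < ψ · a × ψ · d < ψ · a

  -- What an exchange step needs: either endpoint of ab may have to be discarded, so both must be
  -- vertices, and `c` must be off the line ab to start the search for a replacement.
  record ExtremePair (a b c d : Point) : Set (κ ⊔ ℓ) where
    field
      φ         : Functional
      φ-const   : φ · a ≈ φ · b
      c-above   : φ · a < φ · c
      a-extreme : Extreme a b c d
      b-extreme : Extreme b a c d

  -- g is tilted by a large multiple of φ, so that c and d drop below a.
  tilt : ∀ {a b c d} φ g → φ · a ≈ φ · b → g · b < g · a → φ · a < φ · c → φ · a < φ · d →
         Extreme a b c d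
  tilt {a} {b} {c} {d} φ g a≈b b<a a<c a<d =
    build (common-multiplier (g · c - g · a) (g · d - g · a) (<⇒0< a<c) (<⇒0< a<d))
    where
    build : (∃ λ m → g · c - g · a < m * (φ · c - φ · a) × g · d - g · a < m * (φ · d - φ · a)) →
            Extreme a b c d
    build (m , c< , d<) = ψ , b-below , below c c< , below d d<
      where
      ψ : Functional
      ψ = combine 1# g (- m) φ

      ψ-· : ∀ p → ψ · p ≈ g · p + (- m) * φ · p
      ψ-· p = trans (combine-· 1# g (- m) φ p) (+-congʳ (*-identityˡ _))

      b-below : ψ · b < ψ · a
      b-below = <-respˡ-≈ (trans (+-congˡ (*-congˡ a≈b)) (sym (ψ-· b)))
                  (<-respʳ-≈ (sym (ψ-· a)) (+-monoˡ-< ((- m) * φ · a) b<a))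

      below : ∀ p → g · p - g · a < m * (φ · p - φ · a) → ψ · p < ψ · a
      below p p< = <-respˡ-≈ (sym (ψ-· p)) (<-respʳ-≈ (sym (ψ-· a))
        (0<⇒< (<⇒0< p<)
          (solve 5 (λ m ga gp fa fp → m :* (fp :- fa) :- (gp :- ga)
             := (ga :+ (:- m) :* fa) :- (gp :+ (:- m) :* fp))
             refl m (g · a) (g · p) (φ · a) (φ · p))))

  sameSide⇒extremePair : ∀ {a b c d} → ¬ a ≈P b → SameSide a b c d → ExtremePair a b c d
  sameSide⇒extremePair {a} {b} a≉b (sameSide φ a≈b a<c a<d) = record
    { φ = φ ; φ-const = a≈b ; c-above = a<c
    ; a-extreme = tilt φ (neg g) a≈b (neg-< g g-incr) a<c a<d
    ; b-extreme = tilt φ g (sym a≈b) g-incr (<-respˡ-≈ a≈b a<c) (<-respˡ-≈ a≈b a<d)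
    }
    where open Frame (frame a b a≉b) using (g; g-incr)

  -- The line cd passes strictly between `a` and `b`, so on the four points `ψ` has its strict
  -- minimum at `a` and its strict maximum at `b`.
  separated⇒extremePair : ∀ {a b c d} φ ψ → φ · a ≈ φ · b → φ · a < φ · c →
                          ψ · c ≈ ψ · d → ψ · a < ψ · c → ψ · c < ψ · b → ExtremePair a b c d
  separated⇒extremePair φ ψ a≈b a<c c≈d ψa<ψc ψc<ψb = record
    { φ = φ ; φ-const = a≈b ; c-above = a<c
    ; a-extreme = neg ψ , neg-< ψ (<-trans ψa<ψc ψc<ψb) , neg-< ψ ψa<ψc ,
                  neg-< ψ (<-respʳ-≈ c≈d ψa<ψc)
    ; b-extreme = ψ , <-trans ψa<ψc ψc<ψb , ψc<ψb , <-respˡ-≈ c≈d ψc<ψb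
    }

  -- The point `m` of the segment at the `g` height of `c` also shares its `φ` value, and the two
  -- functionals of a frame together determine a point.
  betweenness : ∀ {a b c} (f : Frame a b) → let open Frame f in
                φ · c ≈ φ · a → g · a < g · c → g · c < g · b → InOpenSegment c a b
  betweenness {a} {b} {c} f c≈a a<c c<b = build (positive-inverse (<⇒0< g-incr))
    where
    open Frame f
    A B C : Carrier
    A = g · a
    B = g · b
    C = g · c
    build : (∃ λ i → 0# < i × (B - A) * i ≈ 1#) → InOpenSegment c a b
    build (i , 0<i , inv) = t , 0<t , t<1 , proj₁ c≈m , proj₂ c≈m
      where
      t : Carrier
      t = (C - A) * i
      0<t : 0# < t
      0<t = *-pos (<⇒0< a<c) 0<i
      t<1 : t < 1#
      t<1 = <-respʳ-≈ inv (0<⇒< (*-pos (<⇒0< c<b) 0<i)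
        (solve 4 (λ A B C i → (B :- C) :* i := (B :- A) :* i :- (C :- A) :* i) refl A B C i))
      m : Point
      m = proj₁ a + t * (proj₁ b - proj₁ a) , proj₂ a + t * (proj₂ b - proj₂ a)
      m-· : ∀ ψ → ψ · m ≈ ψ · a + t * (ψ · b - ψ · a)
      m-· = segment-· {m} {a} {b} (t , 0<t , t<1 , refl , refl)
      φ≈ : φ · c ≈ φ · m
      φ≈ = trans c≈a (trans (solve 2 (λ t x → x := x :+ t :* (x :- x)) refl t (φ · a))
             (trans (+-congˡ (*-congˡ (+-congʳ φ-const))) (sym (m-· φ))))
      g≈ : g · c ≈ g · m
      g≈ = trans (solve 2 (λ A C → C := A :+ (C :- A) :* con (+ 1)) refl A C)
             (trans (+-congˡ (*-congˡ (sym inv)))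
             (trans (solve 4 (λ A B C i → A :+ (C :- A) :* ((B :- A) :* i)
                                            := A :+ (C :- A) :* i :* (B :- A)) refl A B C i)
             (sym (m-· g))))
      c≈m : c ≈P m
      c≈m = injective c m φ≈ g≈

  -- If `c` is on the line ab but beyond one end, then `a` and `b` lie on the same side of `c` along
  -- that line. The line cd meets the line ab only in `c`, so they are on the same side of cd too.
  onLine⁺ : ∀ {a b c d} (f : Frame a b) → let open Frame f in
            ¬ InOpenSegment c a b → φ · c ≈ φ · a → φ · c < φ · d →
            c ≈P a ⊎ c ≈P b ⊎ SameSide c d a b
  onLine⁺ {a} {b} {c} {d} f c∉ab φc≈φa c<d = cases (compare (g · c) (g · a)) (compare (g · c) (g · b))
    where
    open Frame f
    -- η is constant on the line cd, and on the line ab it is an increasing function of g.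
    η : Functional
    η = combine (g · c - g · d) φ (φ · d - φ · c) g

    η-· : ∀ p → η · p ≈ (g · c - g · d) * φ · p + (φ · d - φ · c) * g · p
    η-· = combine-· (g · c - g · d) φ (φ · d - φ · c) g

    η-const : η · c ≈ η · d
    η-const = trans (η-· c) (trans
      (solve 4 (λ gc gd φc φd → (gc :- gd) :* φc :+ (φd :- φc) :* gc
                                  := (gc :- gd) :* φd :+ (φd :- φc) :* gd)
        refl (g · c) (g · d) (φ · c) (φ · d))
      (sym (η-· d)))

    η-mono : ∀ {p q} → φ · p ≈ φ · q → g · p < g · q → η · p < η · q
    η-mono {p} {q} φ≈ g< =
      <-respˡ-≈ (trans (+-congˡ (*-congˡ (sym φ≈))) (trans (+-comm _ _) (sym (η-· p))))
        (<-respʳ-≈ (trans (+-comm _ _) (sym (η-· q)))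
          (+-monoˡ-< ((g · c - g · d) * φ · q) (*-monoˡ-<-pos (<⇒0< c<d) g<)))

    φc≈φb : φ · c ≈ φ · b
    φc≈φb = trans φc≈φa φ-const

    cases : Comparison (g · c) (g · a) → Comparison (g · c) (g · b) →
            c ≈P a ⊎ c ≈P b ⊎ SameSide c d a b
    cases (tri≈ _ gc≈ga _) _ = inj₁ (injective c a φc≈φa gc≈ga)
    cases _ (tri≈ _ gc≈gb _) = inj₂ (inj₁ (injective c b φc≈φb gc≈gb))
    cases (tri< c<a _ _) (tri< c<b _ _) =
      inj₂ (inj₂ (sameSide η η-const (η-mono φc≈φa c<a) (η-mono φc≈φb c<b)))
    cases (tri> _ _ a<c) (tri> _ _ b<c) =
      inj₂ (inj₂ (sameSide-below η η-const (η-mono (sym φc≈φa) a<c) (η-mono (sym φc≈φb) b<c)))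
    cases (tri< c<a _ _) (tri> _ _ b<c) =
      contradiction (<-trans (<-trans b<c c<a) g-incr) (irrefl refl)
    cases (tri> _ _ a<c) (tri< c<b _ _) = contradiction (betweenness f φc≈φa a<c c<b) c∉ab

  onLine : ∀ {a b c d} (f : Frame a b) → let open Frame f in
           ¬ InOpenSegment c a b → φ · c ≈ φ · a → ¬ φ · d ≈ φ · a →
           c ≈P a ⊎ c ≈P b ⊎ SameSide c d a b
  onLine {a} {b} {c} {d} f c∉ab c≈a d≉a = cases (compare (φ · c) (φ · d))
    where
    open Frame f
    cases : Comparison (φ · c) (φ · d) → c ≈P a ⊎ c ≈P b ⊎ SameSide c d a b
    cases (tri< c<d _ _) = onLine⁺ f c∉ab c≈a c<d
    cases (tri≈ _ c≈d _) = contradiction (trans (sym c≈d) c≈a) d≉a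
    cases (tri> _ _ d<c) = onLine⁺ (frame-neg f) c∉ab (neg-≈ φ c≈a) (neg-< φ d<c)

  data Position (a b c d : Point) : Set (κ ⊔ ℓ) where
    aligned  : ∀ φ → Nonzero φ → φ · a ≈ φ · b → φ · c ≈ φ · a → φ · d ≈ φ · a → Position a b c d
    touch-ca : c ≈P a → Position a b c d
    touch-cb : c ≈P b → Position a b c d
    touch-da : d ≈P a → Position a b c d
    touch-db : d ≈P b → Position a b c d
    extreme₁ : ExtremePair a b c d → Position a b c d
    extreme₂ : ExtremePair c d a b → Position a b c d

  -- If one of `c`, `d` is on the line ab and the other is not, `onLine` decides. If both are
  -- strictly on one side, ab is the extreme pair. If they are on opposite sides, the same questions
  -- are asked of `a` and `b` relative to the line cd; the remaining case is that of crossing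
  -- segments.
  position : ∀ {a b c d} → ¬ a ≈P b → ¬ c ≈P d →
             ¬ InOpenSegment c a b → ¬ InOpenSegment d a b →
             ¬ InOpenSegment a c d → ¬ InOpenSegment b c d → Position a b c d
  position {a} {b} {c} {d} a≉b c≉d c∉ab d∉ab a∉cd b∉cd =
    relative-to-ab (compare (φ · c) (φ · a)) (compare (φ · d) (φ · a))
    where
    f : Frame a b
    f = frame a b a≉b
    h : Frame c d
    h = frame c d c≉d
    open Frame f
    open Frame h using () renaming (φ to ψ; φ-const to ψ-const; nonzero to ψ-nonzero)

    ab-extreme : SameSide a b c d → Position a b c d
    ab-extreme = extreme₁ ∘ sameSide⇒extremePair a≉b

    cd-extreme : SameSide c d a b → Position a b c d
    cd-extreme = extreme₂ ∘ sameSide⇒extremePair c≉d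

    c-on-ab : φ · c ≈ φ · a → ¬ φ · d ≈ φ · a → Position a b c d
    c-on-ab c≈a d≉a = [ touch-ca , [ touch-cb , cd-extreme ]′ ]′ (onLine f c∉ab c≈a d≉a)

    d-on-ab : φ · d ≈ φ · a → ¬ φ · c ≈ φ · a → Position a b c d
    d-on-ab d≈a c≉a = [ touch-da , [ touch-db , cd-extreme ∘ sameSide-swap ]′ ]′ (onLine f d∉ab d≈a c≉a)

    a-on-cd : ψ · a ≈ ψ · c → ¬ ψ · b ≈ ψ · c → Position a b c d
    a-on-cd a≈c b≉c =
      [ touch-ca ∘ ≈P-sym , [ touch-da ∘ ≈P-sym , ab-extreme ]′ ]′ (onLine h a∉cd a≈c b≉c)

    b-on-cd : ψ · b ≈ ψ · c → ¬ ψ · a ≈ ψ · c → Position a b c d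
    b-on-cd b≈c a≉c =
      [ touch-cb ∘ ≈P-sym , [ touch-db ∘ ≈P-sym , ab-extreme ∘ sameSide-swap ]′ ]′ (onLine h b∉cd b≈c a≉c)

    relative-to-cd : ∀ χ → χ · a ≈ χ · b → χ · a < χ · c →
                     Comparison (ψ · a) (ψ · c) → Comparison (ψ · b) (ψ · c) → Position a b c d
    -- Impossible with `c` off the line ab, but answering `aligned` avoids a refutation.
    relative-to-cd χ _ _ (tri≈ _ a≈c _) (tri≈ _ b≈c _) =
      aligned ψ ψ-nonzero (trans a≈c (sym b≈c)) (sym a≈c) (trans (sym ψ-const) (sym a≈c))
    relative-to-cd χ _ _ (tri≈ _ a≈c _) (tri< _ b≉c _) = a-on-cd a≈c b≉c
    relative-to-cd χ _ _ (tri≈ _ a≈c _) (tri> _ b≉c _) = a-on-cd a≈c b≉c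
    relative-to-cd χ _ _ (tri< _ a≉c _) (tri≈ _ b≈c _) = b-on-cd b≈c a≉c
    relative-to-cd χ _ _ (tri> _ a≉c _) (tri≈ _ b≈c _) = b-on-cd b≈c a≉c
    relative-to-cd χ _ _ (tri< a<c _ _) (tri< b<c _ _) = cd-extreme (sameSide-below ψ ψ-const a<c b<c)
    relative-to-cd χ _ _ (tri> _ _ c<a) (tri> _ _ c<b) = cd-extreme (sameSide ψ ψ-const c<a c<b)
    -- The segments cross, so the line cd separates `a` from `b`.
    relative-to-cd χ χa≈χb χa<χc (tri< a<c _ _) (tri> _ _ c<b) =
      extreme₁ (separated⇒extremePair χ ψ χa≈χb χa<χc ψ-const a<c c<b)
    relative-to-cd χ χa≈χb χa<χc (tri> _ _ c<a) (tri< b<c _ _) =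
      extreme₁ (separated⇒extremePair χ (neg ψ) χa≈χb χa<χc (neg-≈ ψ ψ-const) (neg-< ψ c<a) (neg-< ψ b<c))

    relative-to-ab : Comparison (φ · c) (φ · a) → Comparison (φ · d) (φ · a) → Position a b c d
    relative-to-ab (tri≈ _ c≈a _) (tri≈ _ d≈a _) = aligned φ nonzero φ-const c≈a d≈a
    relative-to-ab (tri≈ _ c≈a _) (tri< _ d≉a _) = c-on-ab c≈a d≉a
    relative-to-ab (tri≈ _ c≈a _) (tri> _ d≉a _) = c-on-ab c≈a d≉a
    relative-to-ab (tri< _ c≉a _) (tri≈ _ d≈a _) = d-on-ab d≈a c≉a
    relative-to-ab (tri> _ c≉a _) (tri≈ _ d≈a _) = d-on-ab d≈a c≉a
    relative-to-ab (tri< c<a _ _) (tri< d<a _ _) = ab-extreme (sameSide-below φ φ-const c<a d<a)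
    relative-to-ab (tri> _ _ a<c) (tri> _ _ a<d) = ab-extreme (sameSide φ φ-const a<c a<d)
    relative-to-ab (tri< c<a _ _) (tri> _ _ _) =
      relative-to-cd (neg φ) (neg-≈ φ φ-const) (neg-< φ c<a) (compare _ _) (compare _ _)
    relative-to-ab (tri> _ _ a<c) (tri< _ _ _) =
      relative-to-cd φ φ-const a<c (compare _ _) (compare _ _)

-- Blocking points and observers in the given point set.

module Connectivity {κ ℓ} (F : OrderedField κ ℓ)
                    (A B : List (OrderedField.Carrier F × OrderedField.Carrier F)) where
  open OrderedField F renaming (_<_ to infix 4 _<_)
  open OrderedFieldProperties F
  open Plane F
  open PlaneProperties F
  open FourPoints F

  S : List Point
  S = A ++ B

  ∪⇒∈S : ∀ {p} → p ∈A∪B (A , B) → p ∈P S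
  ∪⇒∈S = [ ++⁺ˡ , ++⁺ʳ A ]′

  Sees : Point → Point → Set (κ ⊔ ℓ)
  Sees = Visible A B

  sees⇒∉ : ∀ {p v w} → Sees v w → p ∈P S → ¬ InOpenSegment p v w
  sees⇒∉ {p} v-w p∈S = v-w p (++⁻ A p∈S)

  -- The bound is weak because in `hull-shrinks` the discarded vertex lies exactly on the bounding
  -- line.
  Below : Functional → Carrier → Point → Set ℓ
  Below ψ m p = ψ · p < m ⊎ ψ · p ≈ m

  -- Equivalently, p is a convex combination of O and q with positive weight on q.
  Pulled : List Point → Point → Point → Set (κ ⊔ ℓ)
  Pulled O q p = ∀ ψ m → All (Below ψ m) O → ψ · q < m → ψ · p < m

  module _ (φ : Functional) (k : Carrier) (O : List Point) (O-level : All (λ o → φ · o ≈ k) O) where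

    Blocker : List Point → Point → Set (κ ⊔ ℓ)
    Blocker O q = ∃ λ p → p ∈P S × k < φ · p × φ · p < φ · q × Pulled O q p

    -- A point of `S` inside a segment from `q` to some `o` is lower than `q`, still above level
    -- `k`, and by `segment-<-bound` pulled from `q` towards `o`. If no such segment contains a
    -- point, `q` sees all of `O`.
    blocker? : ∀ {q} → k < φ · q → ∀ O → All (λ o → φ · o ≈ k) O → Blocker O q ⊎ All (Sees q) O
    blocker? k<q [] [] = inj₂ []
    blocker? {q} k<q (o ∷ O) (o≈k ∷ O≈k) =
      [ inj₁ ∘ found , continue (blocker? k<q O O≈k) ]′
        (search (λ p → InOpenSegment p q o) (λ {p} {p′} p≈p′ → segment-resp {p} {p′} {q} {q} {o} p≈p′ ≈P-refl)
                (segment? φ {q} {o} o<q) S)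
      where
      o<q : φ · o < φ · q
      o<q = <-respˡ-≈ (sym o≈k) k<q
      found : (∃ λ p → p ∈P S × InOpenSegment p q o) → Blocker (o ∷ O) q
      found (p , p∈S , s) = p , p∈S , <-respˡ-≈ o≈k (proj₁ bounds) , proj₂ bounds ,
                            λ { ψ m (o≤m ∷ _) q<m → segment-<-bound {p} {q} {o} s ψ q<m o≤m }
        where
        bounds : φ · o < φ · p × φ · p < φ · q
        bounds = segment-between {p} {q} {o} s φ o<q
      continue : Blocker O q ⊎ All (Sees q) O → (∀ p → p ∈P S → ¬ InOpenSegment p q o) →
                 Blocker (o ∷ O) q ⊎ All (Sees q) (o ∷ O)
      continue (inj₁ (p , p∈S , k<p , p<q , pull)) _ =
        inj₁ (p , p∈S , k<p , p<q , λ { ψ m (_ ∷ O≤m) → pull ψ m O≤m })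
      continue (inj₂ sees) none = inj₂ ((λ p p∈ → none p (∪⇒∈S p∈)) ∷ sees)

    Observer : Point → Set (κ ⊔ ℓ)
    Observer q = ∃ λ p → p ∈P S × k < φ · p × All (Sees p) O × Pulled O q p

    -- As long as the view from `q` is blocked, `q` moves to a blocker, which is strictly lower. The
    -- list `R` contains the points of `S` lower than `q` and shortens with each move.
    descend : ∀ n R {q} → length R ℕ.< n → (∀ p → p ∈P S → φ · p < φ · q → p ∈P R) →
              q ∈P S → k < φ · q → Observer q
    descend (suc n) R {q} (s≤s |R|≤n) R-covers q∈S k<q = [ move , stop ]′ (blocker? k<q O O-level)
      where
      stop : All (Sees q) O → Observer q
      stop sees = q , q∈S , k<q , sees , λ _ _ _ q<m → q<m

      move : Blocker O q → Observer q
      move (p , p∈S , k<p , p<q , p-pulled) = continue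
        -- The blocker `p` is itself in `R`, being lower than `q`, and drops out because it is not
        -- lower than itself.
        (sublist (λ x≈y → <-respˡ-≈ (·-cong φ x≈y)) (λ x → (φ · x) <? (φ · p)) R
                 (R-covers p p∈S p<q) (irrefl refl))
        where
        continue : (∃ λ R′ → length R′ ℕ.< length R × (∀ x → x ∈P R → φ · x < φ · p → x ∈P R′)) →
                   Observer q
        continue (R′ , shorter , keeps) = conclude
          (descend n R′ (ℕ.<-≤-trans shorter |R|≤n)
            (λ x x∈S x<p → keeps x (R-covers x x∈S (<-trans x<p p<q)) x<p) p∈S k<p)
          where
          conclude : Observer p → Observer q
          conclude (r , r∈S , k<r , sees , r-pulled) =
            -- Pulling is transitive.
            r , r∈S , k<r , sees , λ ψ m O≤m q<m → r-pulled ψ m O≤m (p-pulled ψ m O≤m q<m)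

    observer : ∀ {q} → q ∈P S → k < φ · q → Observer q
    observer = descend (suc (length S)) S (ℕ.n<1+n _) (λ _ p∈S _ → p∈S)

  -- Edges and paths of the bivisibility graph.

  Adj Conn : Point → Point → Set (κ ⊔ ℓ)
  Adj  = BiAdj A B
  Conn = Connected A B

  adj-sym : ∀ {v w} → Adj v w → Adj w v
  adj-sym {v} {w} (colours , sees) =
    ⊎-swap (⊎-map Product.swap Product.swap colours) , λ p p∈ s → sees p p∈ (segment-sym {p} {w} {v} s)

  adj-respˡ : ∀ {v v′ w} → v ≈P v′ → Adj v w → Adj v′ w
  adj-respˡ {v} {v′} {w} v≈v′ (colours , sees) =
    ⊎-map (Product.map₁ (∈P-resp v≈v′)) (Product.map₁ (∈P-resp v≈v′)) colours ,
    λ p p∈ s → sees p p∈ (segment-resp {p} {p} {v′} {v} {w} ≈P-refl (≈P-sym v≈v′) s)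

  adj-∈ˡ : ∀ {v w} → Adj v w → v ∈P S
  adj-∈ˡ (inj₁ (v∈A , _) , _) = ++⁺ˡ v∈A
  adj-∈ˡ (inj₂ (v∈B , _) , _) = ++⁺ʳ A v∈B

  -- The ends of an edge lie in different sets, so one of them lies in the set opposite to that of
  -- `q`.
  adj-either : ∀ {a b q} → Adj a b → q ∈P S → Sees q a → Sees q b → Adj q a ⊎ Adj q b
  adj-either {a} {b} {q} (colours , _) q∈S q-a q-b = choose colours (++⁻ A q∈S)
    where
    choose : (a ∈P A × b ∈P B) ⊎ (a ∈P B × b ∈P A) → q ∈A∪B (A , B) → Adj q a ⊎ Adj q b
    choose (inj₁ (a∈A , b∈B)) (inj₁ q∈A) = inj₂ (inj₁ (q∈A , b∈B) , q-b)
    choose (inj₁ (a∈A , b∈B)) (inj₂ q∈B) = inj₁ (inj₂ (q∈B , a∈A) , q-a)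
    choose (inj₂ (a∈B , b∈A)) (inj₁ q∈A) = inj₁ (inj₁ (q∈A , a∈B) , q-a)
    choose (inj₂ (a∈B , b∈A)) (inj₂ q∈B) = inj₂ (inj₂ (q∈B , b∈A) , q-b)

  conn-sym : ∀ {v w} → Conn v w → Conn w v
  conn-sym = reverse adj-sym

  conn-edge : ∀ {a b q} → Adj a b → Adj q a ⊎ Adj q b → Conn q a
  conn-edge a-b (inj₁ q-a) = q-a ◅ ε
  conn-edge a-b (inj₂ q-b) = q-b ◅ adj-sym a-b ◅ ε

  -- Joining two edges.

  module _ (disjoint : Disjoint A B) (noncollinear : ¬ Collinear S) where

    adj⇒≉ : ∀ {v w} → Adj v w → ¬ v ≈P w
    adj⇒≉ {v} (inj₁ (v∈A , w∈B) , _) v≈w = disjoint v v∈A (∈P-resp (≈P-sym v≈w) w∈B)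
    adj⇒≉ {v} (inj₂ (v∈B , w∈A) , _) v≈w = disjoint v (∈P-resp (≈P-sym v≈w) w∈A) v∈B

    -- If the search finds nothing, stability of the decidable equality puts all of `S` on one line.
    point-off : ∀ φ k → Nonzero φ → ∃ λ p → p ∈P S × ¬ φ · p ≈ k
    point-off φ@(α , β) k nz =
      [ (λ found → found)
      , (λ none → contradiction
          (α , β , k , nz , λ x y p∈S → decidable-stable (_ ≟ k) (none (x , y) p∈S)) noncollinear) ]′
      (search (λ p → ¬ φ · p ≈ k) (λ p≈q p≉k q≈k → p≉k (trans (·-cong φ p≈q) q≈k))
              (λ p → ¬? ((φ · p) ≟ k)) S)

    -- Descending from `q` gives a point that sees all four endpoints, hence is adjacent to an end
    -- of each edge.
    conn-aligned-above : ∀ {a b c d q} → Adj a b → Adj c d → ∀ φ → φ · a ≈ φ · b → φ · c ≈ φ · a → φ · d ≈ φ · a →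
                 q ∈P S → φ · a < φ · q → Conn a c
    conn-aligned-above {a} {b} {c} {d} a-b c-d φ a≈b c≈a d≈a q∈S a<q =
      join (observer φ (φ · a) (a ∷ b ∷ c ∷ d ∷ []) (refl ∷ sym a≈b ∷ c≈a ∷ d≈a ∷ []) q∈S a<q)
      where
      join : Observer φ (φ · a) (a ∷ b ∷ c ∷ d ∷ []) (refl ∷ sym a≈b ∷ c≈a ∷ d≈a ∷ []) _ → Conn a c
      join (r , r∈S , _ , (r-a ∷ r-b ∷ r-c ∷ r-d ∷ []) , _) =
        conn-sym (conn-edge a-b (adj-either a-b r∈S r-a r-b)) ◅◅
        conn-edge c-d (adj-either c-d r∈S r-c r-d)

    conn-aligned : ∀ {a b c d} → Adj a b → Adj c d → ∀ φ → Nonzero φ →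
                   φ · a ≈ φ · b → φ · c ≈ φ · a → φ · d ≈ φ · a → Conn a c
    conn-aligned {a} {b} {c} {d} a-b c-d φ nz a≈b c≈a d≈a = from-point (point-off φ (φ · a) nz)
      where
      from-point : (∃ λ p → p ∈P S × ¬ φ · p ≈ φ · a) → Conn a c
      from-point (p , p∈S , p≉a) = by-side (compare (φ · a) (φ · p))
        where
        by-side : Comparison (φ · a) (φ · p) → Conn a c
        by-side (tri< a<p _ _) = conn-aligned-above a-b c-d φ a≈b c≈a d≈a p∈S a<p
        by-side (tri≈ _ a≈p _) = contradiction (sym a≈p) p≉a
        by-side (tri> _ _ p<a) =
          conn-aligned-above a-b c-d (neg φ) (neg-≈ φ a≈b) (neg-≈ φ c≈a) (neg-≈ φ d≈a) p∈S (neg-< φ p<a)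

    -- The convex hull as the intersection of the open half-planes that contain all four points.
    Hull : Point → Point → Point → Point → Point → Set (κ ⊔ ℓ)
    Hull a b c d p = ∀ φ k → φ · a < k → φ · b < k → φ · c < k → φ · d < k → φ · p < k

    -- The length of `R` bounds the number of points of `S` in the hull and serves as induction
    -- measure.
    Covers : List Point → Point → Point → Point → Point → Set (κ ⊔ ℓ)
    Covers R a b c d = ∀ p → p ∈P S → Hull a b c d p → p ∈P R

    -- Since `q` lies in the triangle x, y, c, the new hull is contained in the old one. It misses
    -- `x`: the functional that is largest at `x` is strictly smaller at `q`, whose weight on `c` is
    -- positive.
    hull-shrinks : ∀ {x y c d q} R → Covers R x y c d → x ∈P S → Extreme x y c d →
                   Pulled (x ∷ y ∷ []) c q →
                   ∃ λ R′ → length R′ ℕ.< length R × Covers R′ q y c d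
    hull-shrinks {x} {y} {c} {d} {q} R covers x∈S (ψ , y<x , c<x , d<x) pulled =
      shrink (sublist (λ p≈p′ p≉x p′≈x → p≉x (≈P-trans p≈p′ p′≈x)) (λ p → ¬? (p ≟P x)) R
                      (covers x x∈S λ _ _ x<k _ _ _ → x<k) (λ x≉x → x≉x ≈P-refl))
      where
      shrink : (∃ λ R′ → length R′ ℕ.< length R × (∀ p → p ∈P R → ¬ p ≈P x → p ∈P R′)) →
               ∃ λ R′ → length R′ ℕ.< length R × Covers R′ q y c d
      shrink (R′ , shorter , keeps) = R′ , shorter , λ p p∈S p∈hull →
        keeps p
          (covers p p∈S λ φ k x<k y<k c<k d<k →
            p∈hull φ k (pulled φ k (inj₁ x<k ∷ inj₁ y<k ∷ []) c<k) y<k c<k d<k)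
          -- The bound is taken to be the value at `x` itself, so `x` enters the pulling condition
          -- with equality.
          (λ p≈x → irrefl (·-cong ψ p≈x)
            (p∈hull ψ (ψ · x) (pulled ψ (ψ · x) (inj₂ refl ∷ inj₁ y<x ∷ []) c<x) y<x c<x d<x))

    -- The number `n` exceeds the length of `R`. A call of `connected` lowers `n` by one, and
    -- `connected-extreme` restores the strict bound by shortening `R`.
    connected : ∀ n R {a b c d} → length R ℕ.< n → Covers R a b c d → Adj a b → Adj c d → Conn a c
    connected-extreme : ∀ n R {a b c d} → length R ℕ.≤ n → Covers R a b c d → Adj a b → Adj c d →
                        ExtremePair a b c d → Conn a c

    connected (suc n) R {a} {b} {c} {d} (s≤s |R|≤n) covers a-b c-d =
      by-position (position (adj⇒≉ a-b) (adj⇒≉ c-d)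
        (sees⇒∉ {c} {a} {b} (proj₂ a-b) (adj-∈ˡ c-d)) (sees⇒∉ {d} {a} {b} (proj₂ a-b) (adj-∈ˡ (adj-sym c-d)))
        (sees⇒∉ {a} {c} {d} (proj₂ c-d) (adj-∈ˡ a-b)) (sees⇒∉ {b} {c} {d} (proj₂ c-d) (adj-∈ˡ (adj-sym a-b))))
      where
      by-position : Position a b c d → Conn a c
      by-position (aligned φ nz a≈b c≈a d≈a) = conn-aligned a-b c-d φ nz a≈b c≈a d≈a
      -- The points are equal only up to `_≈P_`, so the path cannot be empty and goes to `d` and
      -- back.
      by-position (touch-ca c≈a) = adj-respˡ c≈a c-d ◅ adj-sym c-d ◅ ε
      by-position (touch-cb c≈b) = a-b ◅ adj-respˡ c≈b c-d ◅ adj-sym c-d ◅ ε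
      by-position (touch-da d≈a) = adj-respˡ d≈a (adj-sym c-d) ◅ ε
      by-position (touch-db d≈b) = a-b ◅ adj-respˡ d≈b (adj-sym c-d) ◅ ε
      by-position (extreme₁ e) = connected-extreme n R |R|≤n covers a-b c-d e
      -- The two edges exchange roles; the hull does not depend on the order of its points.
      by-position (extreme₂ e) = conn-sym (connected-extreme n R |R|≤n
        (λ p p∈S p∈hull → covers p p∈S λ φ k a< b< c< d< → p∈hull φ k c< d< a< b<) c-d a-b e)

    connected-extreme n R {a} {b} {c} {d} |R|≤n covers a-b c-d e =
      replace (observer φ (φ · a) (a ∷ b ∷ []) (refl ∷ sym φ-const ∷ []) (adj-∈ˡ c-d) c-above)
      where
      open ExtremePair e

      replace : Observer φ (φ · a) (a ∷ b ∷ []) (refl ∷ sym φ-const ∷ []) c → Conn a c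
      replace (q , q∈S , _ , (q-a ∷ q-b ∷ []) , pulled) =
        [ replace-b , replace-a ]′ (adj-either a-b q∈S q-a q-b)
        where
        replace-a : Adj q b → Conn a c
        replace-a q-b = recurse (hull-shrinks R covers (adj-∈ˡ a-b) a-extreme pulled)
          where
          recurse : (∃ λ R′ → length R′ ℕ.< length R × Covers R′ q b c d) → Conn a c
          recurse (R′ , shorter , covers′) =
            -- The vertex `a` leaves the edge but stays connected to `q` through `b`.
            a-b ◅ adj-sym q-b ◅ connected n R′ (ℕ.<-≤-trans shorter |R|≤n) covers′ q-b c-d

        replace-b : Adj q a → Conn a c
        -- Here `b` is the discarded vertex, so `a` and `b` swap places in the hull and in the
        -- pulling condition.
        replace-b q-a = recurse (hull-shrinks R
          (λ p p∈S p∈hull → covers p p∈S λ φ k a< b< → p∈hull φ k b< a<)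
          (adj-∈ˡ (adj-sym a-b)) b-extreme
          (λ { ψ m (b≤m ∷ a≤m ∷ []) → pulled ψ m (a≤m ∷ b≤m ∷ []) }))
          where
          recurse : (∃ λ R′ → length R′ ℕ.< length R × Covers R′ q a c d) → Conn a c
          recurse (R′ , shorter , covers′) =
            adj-sym q-a ◅ connected n R′ (ℕ.<-≤-trans shorter |R|≤n) covers′ q-a c-d

theorem22 : ∀ {c ℓ} (F : OrderedField c ℓ) → let open Plane F in
    (A B : List Point) → Disjoint A B → ¬ Collinear (A ++ B) →
    ∀ u v → u ∈A∪B (A , B) → v ∈A∪B (A , B) →
    NonIsolated A B u → NonIsolated A B v → Connected A B u v
theorem22 F A B disjoint noncollinear u v _ _ (_ , u-u′) (_ , v-v′) =
  -- Each non-isolated vertex brings an edge, and the full list `S` covers any hull.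
  connected disjoint noncollinear (suc (length S)) S (ℕ.n<1+n _) (λ _ p∈S _ → p∈S) u-u′ v-v′
  where open Connectivity F A B
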